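{- The class of weighted languages recognized by WAFA is in general not closed under homomorphisms: there exist a commutative semiring $S$, alphabets $\Gamma,\Sigma$, a non-deleting homomorphism $h:\Gamma^*\to\Sigma^*$, and a weighted language $u:\Gamma^*\to S$ recognized by a WAFA over $S$ and $\Gamma$ such that $h(u):\Sigma^*\to S$ is not recognized by any WAFA over $S$ and $\Sigma$.
   Context: An alphabet is a finite non-empty set; $\Sigma^*$ is the free monoid of finite words over $\Sigma$, $\varepsilon$ the empty word. A homomorphism $h:\Gamma^*\to\Sigma^*$ is a monoid homomorphism; it is non-deleting if $h(a)\neq\varepsilon$ for all $a\in\Gamma$. For non-deleting $h$ and $u:\Gamma^*\to S$, $h(u):\Sigma^*\to S$ is $h(u)(w)=\sum_{v\in h^{ -1}(w)}u(v)$ (a finite sum). A semiring $(S,+,\cdot,0,1)$ has $(S,+,0)$ a commutative monoid, $(S,\cdot,1)$ a monoid, $0$ absorbing, and both distributive laws; it is commutative if $\cdot$ is commutative. For $Q=\{q_1,\dots,q_n\}$, $S[Q]$ is the semiring of polynomials with coefficients in $S$ in commuting indeterminates $q_1,\dots,q_n$, and $p\langle s_1,\dots,s_n\rangle$ denotes simultaneous substitution. A weighted alternating finite automaton (WAFA) over $S$ and $\Sigma$ is $\mathcal A=(Q,\Sigma,\delta,P_0,\tau)$ with $Q=\{q_1,\dots,q_n\}$ a finite set of states, $\delta:Q\times\Sigma\to S[Q]$, $P_0\in S[Q]$, $\tau:Q\to S$. State behavior: $[\mathcal A]_q(\varepsilon)=\tau(q)$, $[\mathcal A]_q(av)=\delta(q,a)\langle[\mathcal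 A]_{q_1}(v),\dots,[\mathcal A]_{q_n}(v)\rangle$ for $a\in\Sigma$. Behavior: $[\![\mathcal A]\!](w)=P_0\langle[\mathcal A]_{q_1}(w),\dots,[\mathcal A]_{q_n}(w)\rangle$. $\mathcal A$ recognizes $s:\Sigma^*\to S$ if $[\![\mathcal A]\!]=s$. -}

module Defs where

open import Algebra.Bundles using (CommutativeSemiring)
open import Algebra.Morphism.Structures using (module MonoidMorphisms)
import Algebra.Definitions.RawSemiring as RawSemiringDefs
open import Data.Fin using (Fin)
import Data.Fin.Properties as Fin
open import Data.List using (List; []; _∷_; [_]; _++_; length; map; foldr; filter; allFin; cartesianProductWith)
open import Data.List.Base using (++-[]-rawMonoid)
open import Data.List.Properties using (≡-dec; length-++; ∷-injective)
open import Data.List.Membership.Propositional using (_∈_)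
open import Data.List.Membership.Propositional.Properties
  using (∈-filter⁺; ∈-filter⁻; ∈-allFin; ∈-cartesianProductWith⁺; ∈-cartesianProductWith⁻)
open import Data.List.Relation.Unary.All as All using ()
open import Data.List.Relation.Unary.AllPairs using ([]; _∷_)
open import Data.List.Relation.Unary.Any using (here; there)
open import Data.List.Relation.Unary.Unique.Propositional using (Unique)
import Data.List.Relation.Unary.Unique.Propositional.Properties as Unique
open import Data.Nat using (ℕ; zero; suc; _≤_; z≤n; s≤s)
import Data.Nat.Properties as ℕ
open import Data.Product using (Σ; _×_; _,_; proj₂)
open import Data.Vec.Functional using (Vector)
open import Function.Bundles using (_⇔_; mk⇔)
open import Level using (Level; _⊔_)
open import Relation.Binary.PropositionalEquality using (_≡_; _≢_; refl; sym; trans; cong; subst)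
open import Relation.Nullary using (contradiction)

private
  variable
    c ℓ : Level
    k l n : ℕ

-- Words over the k-letter set Fin k; alphabets are the sets Fin (suc k).
Word : ℕ → Set
Word k = List (Fin k)

record NonDeletingHom (k l : ℕ) : Set where
  open MonoidMorphisms (++-[]-rawMonoid (Fin k)) (++-[]-rawMonoid (Fin l))
  field
    ⟦_⟧                   : Word k → Word l
    isMonoidHomomorphism : IsMonoidHomomorphism ⟦_⟧
    nonDeleting          : ∀ a → ⟦ [ a ] ⟧ ≢ []

  open IsMonoidHomomorphism isMonoidHomomorphism public using (homo; ε-homo)

wordsUpTo : ∀ k → ℕ → List (Word k)
wordsUpTo k zero    = [ [] ]
wordsUpTo k (suc m) = [] ∷ cartesianProductWith _∷_ (allFin k) (wordsUpTo k m)

-- h⁻¹(w) as a list. A non-deleting h never shortens words, so searching the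
-- words of length at most |w| is exhaustive; `∈-preimage` and
-- `preimage-unique` below state that each preimage is listed exactly once.
preimage : NonDeletingHom k l → Word l → List (Word k)
preimage {k} h w = filter (λ v → ≡-dec Fin._≟_ ⟦ v ⟧ w) (wordsUpTo k (length w))
  where open NonDeletingHom h

∈-wordsUpTo : ∀ m (v : Word k) → length v ≤ m → v ∈ wordsUpTo k m
∈-wordsUpTo zero    []      _         = here refl
∈-wordsUpTo (suc m) []      _         = here refl
∈-wordsUpTo (suc m) (a ∷ v) (s≤s v≤m) =
  there (∈-cartesianProductWith⁺ _∷_ (∈-allFin a) (∈-wordsUpTo m v v≤m))

wordsUpTo-unique : ∀ k m → Unique (wordsUpTo k m)
wordsUpTo-unique k zero    = All.[] ∷ []
wordsUpTo-unique k (suc m) =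
  All.tabulate []∉ ∷
  Unique.cartesianProductWith⁺ _∷_ ∷-injective (Unique.allFin⁺ k) (wordsUpTo-unique k m)
  where
  []∉ : ∀ {v} → v ∈ cartesianProductWith _∷_ (allFin k) (wordsUpTo k m) → [] ≢ v
  []∉ v∈ refl with ∈-cartesianProductWith⁻ _∷_ (allFin k) (wordsUpTo k m) v∈
  ... | _ , _ , _ , _ , ()

length-≤ : (h : NonDeletingHom k l) (v : Word k) → length v ≤ length (NonDeletingHom.⟦_⟧ h v)
length-≤ h []      = z≤n
length-≤ h (a ∷ v) = subst (suc (length v) ≤_)
  (sym (trans (cong length (homo [ a ] v)) (length-++ ⟦ [ a ] ⟧)))
  (ℕ.+-mono-≤ (nonempty ⟦ [ a ] ⟧ (nonDeleting a)) (length-≤ h v))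
  where
  open NonDeletingHom h
  nonempty : ∀ x → x ≢ [] → 1 ≤ length x
  nonempty []      x≢[] = contradiction refl x≢[]
  nonempty (_ ∷ _) _    = s≤s z≤n

∈-preimage : (h : NonDeletingHom k l) (w : Word l) (v : Word k) →
             v ∈ preimage h w ⇔ NonDeletingHom.⟦_⟧ h v ≡ w
∈-preimage {k} h w v = mk⇔
  (λ v∈ → proj₂ (∈-filter⁻ h≟w {xs = wordsUpTo k (length w)} v∈))
  (λ hv≡w → ∈-filter⁺ h≟w
    (∈-wordsUpTo (length w) v (subst (λ x → length v ≤ length x) hv≡w (length-≤ h v))) hv≡w)
  where
  open NonDeletingHom h
  h≟w = λ (u : Word k) → ≡-dec Fin._≟_ ⟦ u ⟧ w

preimage-unique : (h : NonDeletingHom k l) (w : Word l) → Unique (preimage h w)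
preimage-unique {k} h w =
  Unique.filter⁺ (λ v → ≡-dec Fin._≟_ (NonDeletingHom.⟦_⟧ h v) w) (wordsUpTo-unique k (length w))

module _ (S : CommutativeSemiring c ℓ) where
  open CommutativeSemiring S
  open RawSemiringDefs rawSemiring using (_^_; product)

  WeightedLanguage : ℕ → Set c
  WeightedLanguage k = Word k → Carrier

  -- S[q₁,…,qₙ]: a polynomial is given by a finite list of terms
  -- (s , e), standing for the formal sum of the s · q₁^e₁ ⋯ qₙ^eₙ.
  -- Terms may share an exponent vector, so a polynomial has many
  -- representations; substitution gives the same value on all of them.
  Polynomial : ℕ → Set c
  Polynomial n = List (Carrier × Vector ℕ n)

  _⟨_⟩ : Polynomial n → Vector Carrier n → Carrier
  p ⟨ s ⟩ = foldr _+_ 0# (map (λ (a , e) → a * product (λ i → s i ^ e i)) p)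

  -- Weighted alternating finite automata over S and Fin k; the states
  -- q₁,…,qₙ are the elements of Fin n.
  record WAFA (k : ℕ) : Set c where
    field
      states : ℕ
      δ      : Fin states → Fin k → Polynomial states
      P₀     : Polynomial states
      τ      : Fin states → Carrier

    stateBehavior : Word k → Vector Carrier states
    stateBehavior []      q = τ q
    stateBehavior (a ∷ v) q = δ q a ⟨ stateBehavior v ⟩

    behavior : WeightedLanguage k
    behavior w = P₀ ⟨ stateBehavior w ⟩

  Recognizes : WAFA k → WeightedLanguage k → Set ℓ
  Recognizes A s = ∀ w → WAFA.behavior A w ≈ s w

  Recognizable : WeightedLanguage k → Set (c ⊔ ℓ)
  Recognizable {k} s = Σ (WAFA k) λ A → Recognizes A s

  image : NonDeletingHom k l → WeightedLanguage k → WeightedLanguage l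
  image h u w = foldr _+_ 0# (map u (preimage h w))

{-# OPTIONS --safe #-}

-- Take S = ℕ, Γ = {a, b, â}, Σ = {a, b}, and let h erase the hat. The weight
-- u(v) is 2^(2^k) if v contains exactly one â, preceded by k letters b, and is
-- 0 otherwise; a WAFA computes it by squaring at each b. Hence h(u)(w) is the
-- sum of 2^(2^k) over all letters a of w, with k letters b in front of that a.
--
-- Suppose a WAFA with n states recognizes h(u). Modulo M, its state vector
-- after reading w determines h(u)(vw) mod M for every v and takes at most M^n
-- values. Let B = 2^(2^(2n)) and M = B². The B^(2n+1) > M^n words
-- a^(m₀) b a^(m₁) b ⋯ a^(m₂ₙ) b with all mᵢ < B are pairwise separated modulo M
-- by the prefixes b^r: for r = 2n only m₀ B survives modulo M, which gives m₀;
-- then r = 2n - 1 gives m₁, and so on.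
module Submission where

open import Defs
open import Algebra.Bundles using (CommutativeSemiring)
import Algebra.Definitions.RawSemiring as RawSemiringDefs
open import Data.Fin using (Fin; zero; suc; toℕ; combine; funToFin; finToFun)
import Data.Fin.Properties as Fin
open import Data.List using (List; []; _∷_; [_]; _++_; map; replicate)
open import Data.List.Membership.Propositional using (_∈_)
open import Data.List.Membership.Propositional.Properties using (∈-map⁺; ∈-map⁻; ∈-++⁺ˡ; ∈-++⁺ʳ; ∈-++⁻)
open import Data.List.Membership.Propositional.Properties.WithK using (unique∧set⇒bag)
open import Data.List.Properties using (map-++; map-∘; map-cong; ∷-injectiveʳ)
open import Data.List.Relation.Binary.BagAndSetEquality using (∼bag⇒↭)
open import Data.List.Relation.Binary.Permutation.Propositional using (_↭_)
open import Data.List.Relation.Binary.Permutation.Propositional.Properties using () renaming (map⁺ to ↭-map⁺)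
open import Data.List.Relation.Unary.All using ([])
open import Data.List.Relation.Unary.AllPairs using ([]; _∷_)
open import Data.List.Relation.Unary.Any using (here)
open import Data.List.Relation.Unary.Unique.Propositional using (Unique)
import Data.List.Relation.Unary.Unique.Propositional.Properties as Unique
open import Data.Nat using (ℕ; zero; suc; _+_; _*_; _^_; _≤_; _<_; z≤n; s≤s; NonZero; _%_; _/_)
open import Data.Nat.Divisibility using (_∣_; divides; _∣0; ∣-refl; ∣n⇒∣m*n; ∣m∣n⇒∣m+n)
open import Data.Nat.DivMod using (_mod_; m≡m%n+[m/n]*n; [m+kn]%n≡m%n; m<n⇒m%n≡m; m%n<n)
open import Data.Nat.ListAction using (sum)
open import Data.Nat.ListAction.Properties using (sum-++; sum-↭)
open import Data.Nat.Properties
open import Data.Nat.Tactic.RingSolver using (solve-∀)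
open import Data.Product using (Σ; _×_; _,_; ∃₂)
open import Data.Sum using (inj₁; inj₂)
open import Data.Vec.Functional using (Vector)
open import Function using (_∘_; mk⇔; Injective; Equivalence)
open import Level using (0ℓ)
open import Relation.Binary.PropositionalEquality
  using (_≡_; _≗_; refl; sym; trans; cong; cong₂; subst; subst₂; module ≡-Reasoning)
open import Relation.Nullary using (¬_)

-- Letters and double exponentials

ℕ-semiring : CommutativeSemiring 0ℓ 0ℓ
ℕ-semiring = +-*-commutativeSemiring

-- The patterns are overloaded: `a` and `b` are letters of both Γ = `Fin 3` and Σ = `Fin 2`.
pattern a = zero
pattern b = suc zero
pattern â = suc (suc zero)

tower : ℕ → ℕ
tower r = 2 ^ (2 ^ r)

tower≢0 : ∀ r → NonZero (tower r)
tower≢0 r = m^n≢0 2 (2 ^ r)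

square-^ : ∀ x r → (x ^ 2) ^ (2 ^ r) ≡ x ^ (2 ^ suc r)
square-^ x r = ^-*-assoc x 2 (2 ^ r)

tower-suc : ∀ r → tower (suc r) ≡ tower r * tower r
tower-suc r = begin
  2 ^ (2 ^ r + (2 ^ r + 0))  ≡⟨ cong (λ k → 2 ^ (2 ^ r + k)) (+-identityʳ (2 ^ r)) ⟩
  2 ^ (2 ^ r + 2 ^ r)        ≡⟨ ^-distribˡ-+-* 2 (2 ^ r) (2 ^ r) ⟩
  tower r * tower r          ∎
  where open ≡-Reasoning

tower-∣ : ∀ {r s} → r ≤ s → tower r ∣ tower s
tower-∣ = go ∘ ≤⇒≤′
  where
  open Data.Nat using (_≤′_; ≤′-reflexive; ≤′-step)
  go : ∀ {r s} → r ≤′ s → tower r ∣ tower s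
  go (≤′-reflexive refl)   = ∣-refl
  go (≤′-step {n = s} r≤s) = subst (_ ∣_) (sym (tower-suc s)) (∣n⇒∣m*n (tower s) (go r≤s))

1<tower : ∀ r → 1 < tower r
1<tower r = ^-monoʳ-< 2 (s≤s (s≤s z≤n)) {0} (m^n>0 2 r)

-- Congruence in ℕ

infix 4 _≡_[mod_]

-- Multiples of the modulus are added on both sides, which expresses congruence without subtraction
-- and reduces compatibility with sums and products to ring identities.
_≡_[mod_] : ℕ → ℕ → ℕ → Set
x ≡ y [mod M ] = ∃₂ λ p q → x + p * M ≡ y + q * M

module _ {M : ℕ} where

  mod-refl : ∀ {x} → x ≡ x [mod M ]
  mod-refl = 0 , 0 , refl

  +-mod-cong : ∀ {x y x′ y′} → x ≡ y [mod M ] → x′ ≡ y′ [mod M ] → x + x′ ≡ y + y′ [mod M ]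
  +-mod-cong {x} {y} {x′} {y′} (p , q , eq) (p′ , q′ , eq′) =
    p + p′ , q + q′ , (begin
      x + x′ + (p + p′) * M       ≡⟨ regroup x x′ p p′ M ⟩
      (x + p * M) + (x′ + p′ * M) ≡⟨ cong₂ _+_ eq eq′ ⟩
      (y + q * M) + (y′ + q′ * M) ≡⟨ regroup y y′ q q′ M ⟨
      y + y′ + (q + q′) * M       ∎)
    where
    open ≡-Reasoning
    regroup : ∀ x x′ p p′ M → x + x′ + (p + p′) * M ≡ (x + p * M) + (x′ + p′ * M)
    regroup = solve-∀

  *-mod-cong : ∀ {x y x′ y′} → x ≡ y [mod M ] → x′ ≡ y′ [mod M ] → x * x′ ≡ y * y′ [mod M ]
  *-mod-cong {x} {y} {x′} {y′} (p , q , eq) (p′ , q′ , eq′) =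
    p * x′ + x * p′ + p * p′ * M , q * y′ + y * q′ + q * q′ * M , (begin
      x * x′ + (p * x′ + x * p′ + p * p′ * M) * M ≡⟨ expand x x′ p p′ M ⟩
      (x + p * M) * (x′ + p′ * M)                 ≡⟨ cong₂ _*_ eq eq′ ⟩
      (y + q * M) * (y′ + q′ * M)                 ≡⟨ expand y y′ q q′ M ⟨
      y * y′ + (q * y′ + y * q′ + q * q′ * M) * M ∎)
    where
    open ≡-Reasoning
    expand : ∀ x x′ p p′ M → x * x′ + (p * x′ + x * p′ + p * p′ * M) * M ≡ (x + p * M) * (x′ + p′ * M)
    expand = solve-∀

  +-mod-cancelˡ : ∀ z {x y} → z + x ≡ z + y [mod M ] → x ≡ y [mod M ]
  +-mod-cancelˡ z {x} {y} (p , q , eq) = p , q , +-cancelˡ-≡ z _ _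
    (trans (sym (+-assoc z x (p * M))) (trans eq (+-assoc z y (q * M))))

mod-≡⇒≡[mod] : ∀ {M} .{{_ : NonZero M}} {x y} → x mod M ≡ y mod M → x ≡ y [mod M ]
-- The quotients are exchanged, so that each side becomes the common remainder plus both multiples
-- of `M`.
mod-≡⇒≡[mod] {M} {x} {y} eq = y / M , x / M , (begin
  x + y / M * M                  ≡⟨ cong (_+ y / M * M) (m≡m%n+[m/n]*n x M) ⟩
  x % M + x / M * M + y / M * M  ≡⟨ cong (λ r → r + x / M * M + y / M * M) %-eq ⟩
  y % M + x / M * M + y / M * M  ≡⟨ swap (y % M) (x / M * M) (y / M * M) ⟩
  y % M + y / M * M + x / M * M  ≡⟨ cong (_+ x / M * M) (m≡m%n+[m/n]*n y M) ⟨
  y + x / M * M                  ∎)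
  where
  open ≡-Reasoning
  %-eq : x % M ≡ y % M
  %-eq = trans (sym (Fin.toℕ-fromℕ< (m%n<n x M))) (trans (cong toℕ eq) (Fin.toℕ-fromℕ< (m%n<n y M)))
  swap : ∀ r s t → r + s + t ≡ r + t + s
  swap = solve-∀

-- Modulo B² both `s` and `s′` vanish. Cancelling one factor `B` leaves a congruence of `m` and `m′`
-- modulo `B`, and both are below `B`.
mod-square-digit : ∀ {B m m′ s s′} .{{_ : NonZero B}} → m < B → m′ < B →
                   B * B ∣ s → B * B ∣ s′ →
                   m * B + s ≡ m′ * B + s′ [mod B * B ] → m ≡ m′
mod-square-digit {B} {m} {m′} m<B m′<B (divides t refl) (divides t′ refl) (p , q , eq) = begin
  m                      ≡⟨ m<n⇒m%n≡m m<B ⟨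
  m % B                  ≡⟨ [m+kn]%n≡m%n m (t + p) B ⟨
  (m + (t + p) * B) % B  ≡⟨ cong (_% B) (*-cancelʳ-≡ _ _ B
                              (trans (factor m t p B) (trans eq (sym (factor m′ t′ q B))))) ⟩
  (m′ + (t′ + q) * B) % B ≡⟨ [m+kn]%n≡m%n m′ (t′ + q) B ⟩
  m′ % B                 ≡⟨ m<n⇒m%n≡m m′<B ⟩
  m′                     ∎
  where
  open ≡-Reasoning
  factor : ∀ m t p B → (m + (t + p) * B) * B ≡ m * B + t * (B * B) + p * (B * B)
  factor = solve-∀

-- Automata over ℕ modulo M

module _ {M : ℕ} where
  open RawSemiringDefs (CommutativeSemiring.rawSemiring ℕ-semiring) using (product)
    renaming (_^_ to _^ˢ_)

  ^ˢ-mod-cong : ∀ {x y} n → x ≡ y [mod M ] → x ^ˢ n ≡ y ^ˢ n [mod M ]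
  ^ˢ-mod-cong zero    x≡y = mod-refl
  ^ˢ-mod-cong (suc n) x≡y = *-mod-cong x≡y (^ˢ-mod-cong n x≡y)

  product-mod-cong : ∀ {n} {f g : Vector ℕ n} → (∀ i → f i ≡ g i [mod M ]) →
                     product f ≡ product g [mod M ]
  product-mod-cong {zero}  f≡g = mod-refl
  product-mod-cong {suc n} f≡g = *-mod-cong (f≡g zero) (product-mod-cong (f≡g ∘ suc))

  ⟨⟩-mod-cong : ∀ {n} (p : Polynomial ℕ-semiring n) {s t : Vector ℕ n} →
                (∀ i → s i ≡ t i [mod M ]) →
                _⟨_⟩ ℕ-semiring p s ≡ _⟨_⟩ ℕ-semiring p t [mod M ]
  ⟨⟩-mod-cong []            s≡t = mod-refl
  ⟨⟩-mod-cong ((x , e) ∷ p) s≡t = +-mod-cong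
    (*-mod-cong (mod-refl {x = x}) (product-mod-cong (λ i → ^ˢ-mod-cong (e i) (s≡t i))))
    (⟨⟩-mod-cong p s≡t)

  module _ {k : ℕ} (A : WAFA ℕ-semiring k) where
    open WAFA A

    -- A word is evaluated from its right end, so the state vector of `v ++ w` is a polynomial
    -- function of that of `w`, and polynomials respect congruence.
    stateBehavior-mod-cong : ∀ v {w w′} → (∀ q → stateBehavior w q ≡ stateBehavior w′ q [mod M ]) →
                             ∀ q → stateBehavior (v ++ w) q ≡ stateBehavior (v ++ w′) q [mod M ]
    stateBehavior-mod-cong []      eq q = eq q
    stateBehavior-mod-cong (x ∷ v) eq q = ⟨⟩-mod-cong (δ q x) (stateBehavior-mod-cong v eq)

    behavior-mod-cong : ∀ v {w w′} → (∀ q → stateBehavior w q ≡ stateBehavior w′ q [mod M ]) →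
                        behavior (v ++ w) ≡ behavior (v ++ w′) [mod M ]
    behavior-mod-cong v eq = ⟨⟩-mod-cong P₀ (stateBehavior-mod-cong v eq)

-- The weighted language u and its image

-- State 0 has weight 1 on the words without â and 0 on all others.
marking : WAFA ℕ-semiring 3
marking = record
  { states = 2
  ; δ      = δ
  ; P₀     = [ 1 , only-1 1 ]
  ; τ      = λ { zero → 1 ; (suc zero) → 0 }
  }
  where
  only-0 only-1 : ℕ → Vector ℕ 2
  only-0 n = λ { zero → n ; (suc zero) → 0 }
  only-1 n = λ { zero → 0 ; (suc zero) → n }
  δ : Fin 2 → Fin 3 → Polynomial ℕ-semiring 2
  δ zero       a = [ 1 , only-0 1 ]
  δ zero       b = [ 1 , only-0 1 ]
  δ zero       â = []
  δ (suc zero) a = [ 1 , only-1 1 ]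
  δ (suc zero) b = [ 1 , only-1 2 ]
  -- The coefficient 2 is `tower 0`, the value before any squaring; the factor from state 0 excludes
  -- a second hat further right.
  δ (suc zero) â = [ 2 , only-0 1 ]

u : WeightedLanguage ℕ-semiring 3
u = WAFA.behavior marking

unmarked : Word 3 → ℕ
unmarked v = WAFA.stateBehavior marking v zero

marked : Word 3 → ℕ
marked v = WAFA.stateBehavior marking v (suc zero)

unmarked-a : ∀ v → unmarked (a ∷ v) ≡ unmarked v
unmarked-a v = lemma (unmarked v)
  where
  -- The left side is the substitution unfolded: coefficient, power of each state's value, empty
  -- product, empty sum.
  lemma : ∀ x → 1 * ((x * 1) * (1 * 1)) + 0 ≡ x
  lemma = solve-∀

unmarked-b : ∀ v → unmarked (b ∷ v) ≡ unmarked v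
unmarked-b = unmarked-a

marked-a : ∀ v → marked (a ∷ v) ≡ marked v
marked-a v = lemma (marked v)
  where
  lemma : ∀ x → 1 * (1 * ((x * 1) * 1)) + 0 ≡ x
  lemma = solve-∀

marked-b : ∀ v → marked (b ∷ v) ≡ marked v ^ 2
marked-b v = lemma (marked v)
  where
  lemma : ∀ x → 1 * (1 * ((x * (x * 1)) * 1)) + 0 ≡ x * (x * 1)
  lemma = solve-∀

marked-â : ∀ v → marked (â ∷ v) ≡ 2 * unmarked v
marked-â v = lemma (unmarked v)
  where
  lemma : ∀ x → 2 * ((x * 1) * (1 * 1)) + 0 ≡ 2 * x
  lemma = solve-∀

-- `P₀` is the same polynomial as the transition of state 1 at `a`, so `u v` unfolds to the same
-- term as `marked (a ∷ v)`.
u≡marked : ∀ v → u v ≡ marked v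
u≡marked = marked-a

erase : Fin 3 → Fin 2
erase a = a
erase b = b
erase â = a

h : NonDeletingHom 3 2
h = record
  { ⟦_⟧                  = map erase
  ; isMonoidHomomorphism = record
      { isMagmaHomomorphism = record
          { isRelHomomorphism = record { cong = cong (map erase) }
          ; homo              = map-++ erase
          }
      ; ε-homo              = refl
      }
  ; nonDeleting          = λ _ ()
  }

-- Enumeration of the preimages under h

-- Unlike the filtered list `preimage h w`, this list of preimages is built by recursion on the
-- word, which allows sums over it to be computed by induction.
markings : Word 2 → List (Word 3)
markings []      = [ [] ]
markings (a ∷ w) = map (a ∷_) (markings w) ++ map (â ∷_) (markings w)
markings (b ∷ w) = map (b ∷_) (markings w)

∈-markings⁺ : ∀ v → v ∈ markings (map erase v)
∈-markings⁺ []      = here refl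
∈-markings⁺ (a ∷ v) = ∈-++⁺ˡ (∈-map⁺ (a ∷_) (∈-markings⁺ v))
∈-markings⁺ (b ∷ v) = ∈-map⁺ (b ∷_) (∈-markings⁺ v)
∈-markings⁺ (â ∷ v) = ∈-++⁺ʳ (map (a ∷_) (markings (map erase v))) (∈-map⁺ (â ∷_) (∈-markings⁺ v))

∈-markings⁻ : ∀ w {v} → v ∈ markings w → map erase v ≡ w
∈-markings⁻ []      (here refl) = refl
∈-markings⁻ (a ∷ w) v∈ with ∈-++⁻ (map (a ∷_) (markings w)) v∈
... | inj₁ v∈ˡ with _ , v′∈ , refl ← ∈-map⁻ (a ∷_) v∈ˡ = cong (a ∷_) (∈-markings⁻ w v′∈)
... | inj₂ v∈ʳ with _ , v′∈ , refl ← ∈-map⁻ (â ∷_) v∈ʳ = cong (a ∷_) (∈-markings⁻ w v′∈)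
∈-markings⁻ (b ∷ w) v∈ with _ , v′∈ , refl ← ∈-map⁻ (b ∷_) v∈ = cong (b ∷_) (∈-markings⁻ w v′∈)

markings-unique : ∀ w → Unique (markings w)
markings-unique []      = [] ∷ []
markings-unique (a ∷ w) = Unique.++⁺
  (Unique.map⁺ ∷-injectiveʳ (markings-unique w))
  (Unique.map⁺ ∷-injectiveʳ (markings-unique w))
  disjoint
  where
  disjoint : ∀ {v} → ¬ (v ∈ map (a ∷_) (markings w) × v ∈ map (â ∷_) (markings w))
  disjoint (v∈ˡ , v∈ʳ) with _ , _ , refl ← ∈-map⁻ (a ∷_) v∈ˡ | _ , _ , () ← ∈-map⁻ (â ∷_) v∈ʳ
markings-unique (b ∷ w) = Unique.map⁺ ∷-injectiveʳ (markings-unique w)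

-- Two duplicate-free lists with the same members are permutations of each other; sums over them
-- therefore agree.
preimage↭markings : ∀ w → preimage h w ↭ markings w
preimage↭markings w = ∼bag⇒↭ (unique∧set⇒bag (preimage-unique h w) (markings-unique w)
  (λ {v} → mk⇔
    (λ v∈ → subst (λ x → v ∈ markings x) (Equivalence.to (∈-preimage h w v) v∈) (∈-markings⁺ v))
    (λ v∈ → Equivalence.from (∈-preimage h w v) (∈-markings⁻ w v∈))))

sum-map-∷ : ∀ {k} {f g : Word k → ℕ} {x} → (∀ v → f (x ∷ v) ≡ g v) →
            ∀ vs → sum (map f (map (x ∷_) vs)) ≡ sum (map g vs)
sum-map-∷ f≗g vs = cong sum (trans (sym (map-∘ vs)) (map-cong f≗g vs))

sum-map-0 : ∀ {A : Set} {f : A → ℕ} → (∀ x → f x ≡ 0) → ∀ xs → sum (map f xs) ≡ 0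
sum-map-0 f≗0 []       = refl
sum-map-0 f≗0 (x ∷ xs) = cong₂ _+_ (f≗0 x) (sum-map-0 f≗0 xs)

sum-markings-a : ∀ (f : Word 3 → ℕ) w →
                 sum (map f (markings (a ∷ w))) ≡
                 sum (map f (map (a ∷_) (markings w))) + sum (map f (map (â ∷_) (markings w)))
sum-markings-a f w = trans
  (cong sum (map-++ f (map (a ∷_) (markings w)) (map (â ∷_) (markings w))))
  (sum-++ (map f (map (a ∷_) (markings w))) _)

-- Closed form of h(u)

-- The index `r` counts the letters `b` already passed, so h(u) is the case of initial index 0.
markSum : ℕ → Word 2 → ℕ
markSum r []      = 0
markSum r (a ∷ w) = tower r + markSum r w
markSum r (b ∷ w) = markSum (suc r) w

0^2^ : ∀ r → 0 ^ (2 ^ r) ≡ 0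
0^2^ r with 2 ^ r | m^n>0 2 r
... | suc _ | _ = refl

-- Exactly one marking of `w` has no hat. It contributes 2^(2^r), and every other one contributes a
-- positive power of 0.
sum-unmarked : ∀ r w → sum (map (λ v → (2 * unmarked v) ^ (2 ^ r)) (markings w)) ≡ tower r
sum-unmarked r []      = +-identityʳ (tower r)
sum-unmarked r (a ∷ w) = begin
  sum (map f (markings (a ∷ w)))                                                          ≡⟨ sum-markings-a f w ⟩
  sum (map f (map (a ∷_) (markings w))) + sum (map f (map (â ∷_) (markings w)))
    ≡⟨ cong₂ _+_ (sum-map-∷ (λ v → cong (λ x → (2 * x) ^ (2 ^ r)) (unmarked-a v)) (markings w))
                 (sum-map-∷ (λ v → 0^2^ r) (markings w)) ⟩
  sum (map f (markings w)) + sum (map (λ _ → 0) (markings w))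
    ≡⟨ cong₂ _+_ (sum-unmarked r w) (sum-map-0 (λ _ → refl) (markings w)) ⟩
  tower r + 0                                                                             ≡⟨ +-identityʳ _ ⟩
  tower r                                                                                 ∎
  where
  open ≡-Reasoning
  f : Word 3 → ℕ
  f v = (2 * unmarked v) ^ (2 ^ r)
sum-unmarked r (b ∷ w) = trans
  (sum-map-∷ (λ v → cong (λ x → (2 * x) ^ (2 ^ r)) (unmarked-b v)) (markings w))
  (sum-unmarked r w)

-- The exponent 2^r accounts for `r` squarings by letters `b` further left, which keeps the
-- induction going past each `b`. At a letter `a`, the hatted choice contributes `tower r` by
-- `sum-unmarked`.
sum-marked : ∀ r w → sum (map (λ v → marked v ^ (2 ^ r)) (markings w)) ≡ markSum r w
sum-marked r []      = trans (+-identityʳ _) (0^2^ r)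
sum-marked r (a ∷ w) = begin
  sum (map f (markings (a ∷ w)))                                                          ≡⟨ sum-markings-a f w ⟩
  sum (map f (map (a ∷_) (markings w))) + sum (map f (map (â ∷_) (markings w)))
    ≡⟨ cong₂ _+_ (sum-map-∷ (λ v → cong (_^ (2 ^ r)) (marked-a v)) (markings w))
                 (sum-map-∷ (λ v → cong (_^ (2 ^ r)) (marked-â v)) (markings w)) ⟩
  sum (map f (markings w)) + sum (map (λ v → (2 * unmarked v) ^ (2 ^ r)) (markings w))
    ≡⟨ cong₂ _+_ (sum-marked r w) (sum-unmarked r w) ⟩
  markSum r w + tower r                                                                   ≡⟨ +-comm (markSum r w) _ ⟩
  tower r + markSum r w                                                                   ∎
  where
  open ≡-Reasoning
  f : Word 3 → ℕ
  f v = marked v ^ (2 ^ r)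
sum-marked r (b ∷ w) = trans
  (sum-map-∷ (λ v → trans (cong (_^ (2 ^ r)) (marked-b v)) (square-^ (marked v) r)) (markings w))
  (sum-marked (suc r) w)

image-markSum : ∀ w → image ℕ-semiring h u w ≡ markSum 0 w
image-markSum w = begin
  sum (map u (preimage h w))                   ≡⟨ sum-↭ (↭-map⁺ u (preimage↭markings w)) ⟩
  sum (map u (markings w))                     ≡⟨ cong sum (map-cong u≡marked^1 (markings w)) ⟩
  sum (map (λ v → marked v ^ 1) (markings w))  ≡⟨ sum-marked 0 w ⟩
  markSum 0 w                                  ∎
  where
  open ≡-Reasoning
  u≡marked^1 : ∀ v → u v ≡ marked v ^ 1
  u≡marked^1 v = trans (u≡marked v) (sym (*-identityʳ (marked v)))

-- Separation of the block words

blocks : ∀ {J} → Vector ℕ J → Word 2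
blocks {zero}  m = []
blocks {suc J} m = replicate (m zero) a ++ b ∷ blocks (m ∘ suc)

markSum-b^ : ∀ r s w → markSum s (replicate r b ++ w) ≡ markSum (r + s) w
markSum-b^ zero    s w = refl
markSum-b^ (suc r) s w = trans (markSum-b^ r (suc s) w) (cong (λ t → markSum t w) (+-suc r s))

markSum-a^ : ∀ n r w → markSum r (replicate n a ++ w) ≡ n * tower r + markSum r w
markSum-a^ zero    r w = refl
markSum-a^ (suc n) r w = trans (cong (tower r +_) (markSum-a^ n r w)) (sym (+-assoc (tower r) _ _))

markSum-blocks : ∀ {J} r (m : Vector ℕ (suc J)) →
                 markSum r (blocks m) ≡ m zero * tower r + markSum (suc r) (blocks (m ∘ suc))
markSum-blocks r m = markSum-a^ (m zero) r (b ∷ blocks (m ∘ suc))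

-- Every summand is `tower s` for some s ≥ r.
tower-∣-markSum : ∀ {K r} w → K ≤ r → tower K ∣ markSum r w
tower-∣-markSum []      K≤r = _ ∣0
tower-∣-markSum (a ∷ w) K≤r = ∣m∣n⇒∣m+n (tower-∣ K≤r) (tower-∣-markSum w K≤r)
tower-∣-markSum (b ∷ w) K≤r = tower-∣-markSum w (m≤n⇒m≤1+n K≤r)

-- The lower bound c counts the blocks already decoded: the r-th test of the
-- remaining blocks is obtained from the (r - 1)-st one.
blocks-separated : ∀ {K J} c {m m′ : Vector ℕ J} →
                   (∀ i → m i < tower K) → (∀ i → m′ i < tower K) → c + J ≤ suc K →
                   (∀ r → c ≤ r → markSum r (blocks m) ≡ markSum r (blocks m′) [mod tower K * tower K ]) →
                   ∀ i → m i ≡ m′ i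
blocks-separated {K} {suc J} c {m} {m′} m< m′< c+J≤K tests = λ
  { zero    → first
  ; (suc i) → blocks-separated (suc c) (m< ∘ suc) (m′< ∘ suc) (subst (_≤ suc K) (+-suc c J) c+J≤K) tests′ i
  }
  where
  M : ℕ
  M = tower K * tower K

  M∣markSum : ∀ w → M ∣ markSum (suc K) w
  M∣markSum w = subst (_∣ markSum (suc K) w) (tower-suc K) (tower-∣-markSum w ≤-refl)

  split : ∀ r → c ≤ r → m zero * tower r + markSum (suc r) (blocks (m ∘ suc)) ≡
                        m′ zero * tower r + markSum (suc r) (blocks (m′ ∘ suc)) [mod M ]
  split r c≤r = subst₂ (_≡_[mod M ]) (markSum-blocks r m) (markSum-blocks r m′) (tests r c≤r)

  c≤K : c ≤ K
  -- At least one block remains, so the bound leaves room for the test with r = K.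
  c≤K = ≤-trans (m≤m+n c J) (≤-pred (subst (_≤ suc K) (+-suc c J) c+J≤K))

  first : m zero ≡ m′ zero
  -- In the test with r = K all later blocks have index above `K` and contribute multiples of `M`,
  -- which equals `tower (suc K)`.
  first = mod-square-digit {{tower≢0 K}} (m< zero) (m′< zero)
    (M∣markSum (blocks (m ∘ suc))) (M∣markSum (blocks (m′ ∘ suc))) (split K c≤K)

  tests′ : ∀ r → suc c ≤ r → markSum r (blocks (m ∘ suc)) ≡ markSum r (blocks (m′ ∘ suc)) [mod M ]
  tests′ (suc r) (s≤s c≤r) = +-mod-cancelˡ (m zero * tower r)
    (subst (λ d → m zero * tower r + _ ≡ d * tower r + _ [mod M ]) (sym first) (split r c≤r))

-- The counting argument

-- Stands in for function extensionality: the digits of two indices are only compared pointwise.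
funToFin-cong : ∀ {m n} {f g : Fin m → Fin n} → f ≗ g → funToFin f ≡ funToFin g
funToFin-cong {zero}  f≗g = refl
funToFin-cong {suc m} f≗g = cong₂ combine (f≗g zero) (funToFin-cong (f≗g ∘ suc))

image-notRecognizable : ¬ Recognizable ℕ-semiring (image ℕ-semiring h u)
image-notRecognizable (A , recognizes) =
  <⇒≱ M^n<B^[1+K] (Fin.injective⇒≤ stateClass-injective)
  where
  open WAFA A

  n K B M : ℕ
  n = states
  -- With this choice M^n equals B^K, so `suc K` blocks give more words than there are state vectors
  -- modulo `M`.
  K = 2 * n
  B = tower K
  M = B * B

  instance
    M≢0 : NonZero M
    M≢0 = m*n≢0 B B {{tower≢0 K}} {{tower≢0 K}}

  word : Fin (B ^ suc K) → Word 2
  -- The block lengths are the `suc K` digits of `i` in base `B`.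
  word i = blocks (toℕ ∘ finToFun {B} {suc K} i)

  stateClass : Fin (B ^ suc K) → Fin (M ^ n)
  stateClass i = funToFin (λ q → stateBehavior (word i) q mod M)

  tests : ∀ {i j} → stateClass i ≡ stateClass j →
          ∀ r → markSum r (word i) ≡ markSum r (word j) [mod M ]
  tests {i} {j} eq r = subst₂ (_≡_[mod M ]) (test i) (test j)
    (behavior-mod-cong A (replicate r b) {word i} {word j} same-states)
    where
    test : ∀ i → behavior (replicate r b ++ word i) ≡ markSum r (word i)
    test i = begin
      behavior (replicate r b ++ word i)              ≡⟨ recognizes (replicate r b ++ word i) ⟩
      image ℕ-semiring h u (replicate r b ++ word i)  ≡⟨ image-markSum (replicate r b ++ word i) ⟩
      markSum 0 (replicate r b ++ word i)             ≡⟨ markSum-b^ r 0 (word i) ⟩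
      markSum (r + 0) (word i)                        ≡⟨ cong (λ s → markSum s (word i)) (+-identityʳ r) ⟩
      markSum r (word i)                              ∎
      where open ≡-Reasoning

    same-states : ∀ q → stateBehavior (word i) q ≡ stateBehavior (word j) q [mod M ]
    same-states q = mod-≡⇒≡[mod] (begin
      stateBehavior (word i) q mod M  ≡⟨ Fin.finToFun-funToFin (λ q → stateBehavior (word i) q mod M) q ⟨
      finToFun (stateClass i) q       ≡⟨ cong (λ x → finToFun {M} {n} x q) eq ⟩
      finToFun (stateClass j) q       ≡⟨ Fin.finToFun-funToFin (λ q → stateBehavior (word j) q mod M) q ⟩
      stateBehavior (word j) q mod M  ∎)
      where open ≡-Reasoning

  stateClass-injective : Injective _≡_ _≡_ stateClass
  stateClass-injective {i} {j} eq = begin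
    i                                    ≡⟨ Fin.funToFin-finToFin {suc K} {B} i ⟨
    funToFin (finToFun {B} {suc K} i)    ≡⟨ funToFin-cong (λ x → Fin.toℕ-injective (digits x)) ⟩
    funToFin (finToFun {B} {suc K} j)    ≡⟨ Fin.funToFin-finToFin {suc K} {B} j ⟩
    j                                    ∎
    where
    open ≡-Reasoning
    digits : ∀ x → toℕ (finToFun {B} {suc K} i x) ≡ toℕ (finToFun {B} {suc K} j x)
    -- Initially no block is decoded, and the bound 0 + suc K ≤ suc K holds with equality.
    digits = blocks-separated {K} 0 (λ x → Fin.toℕ<n _) (λ x → Fin.toℕ<n _) ≤-refl (λ r _ → tests eq r)

  M^n<B^[1+K] : M ^ n < B ^ suc K
  M^n<B^[1+K] = begin-strict
    (B * B) ^ n  ≡⟨ cong (λ x → (B * x) ^ n) (*-identityʳ B) ⟨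
    (B ^ 2) ^ n  ≡⟨ ^-*-assoc B 2 n ⟩
    B ^ K        <⟨ ^-monoʳ-< B (1<tower K) (n<1+n K) ⟩
    B ^ suc K    ∎
    where open ≤-Reasoning

lemma5p3 : Σ (CommutativeSemiring 0ℓ 0ℓ) λ S →
    Σ ℕ λ k → Σ ℕ λ l →
    Σ (NonDeletingHom (suc k) (suc l)) λ h →
    Σ (WeightedLanguage S (suc k)) λ u →
    Recognizable S u × ¬ Recognizable S (image S h u)
-- Alphabet sizes are successors, so 2 and 1 stand for three and two letters.
lemma5p3 = ℕ-semiring , 2 , 1 , h , u , (marking , λ _ → refl) , image-notRecognizable
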